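{- Let $m$ be a positive integer and let $a_1,a_2,K$ be integers with $0\le a_1,a_2,K\le m-1$. Then $$S_m(\{a_1,a_2\},K)\le\left\lfloor\frac{m}{2}\right\rfloor.$$
   Context: For a positive integer $m$ and non-negative integers $a_1,a_2,K$ (with $a_1=a_2$ allowed; $\{a_1,a_2\}$ is just a list of parameters), define $$S_m(\{a_1,a_2\},K)=\sum_{k=0}^K\left(\left\lfloor\frac{a_1+a_2+k}{m}\right\rfloor-\left\lfloor\frac{a_1+k}{m}\right\rfloor-\left\lfloor\frac{a_2+k}{m}\right\rfloor+\left\lfloor\frac{k}{m}\right\rfloor\right).$$ -}

module Defs where

open import Data.Nat.Base as ℕ using (ℕ; suc; NonZero)
open import Data.Nat.DivMod using (_/_)
open import Data.Integer.Base using (ℤ; +_; 0ℤ; _+_; _-_)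
open import Data.List.Base using (foldr; applyUpTo)

-- Both endpoints are included.
sum₀ : ℕ → (ℕ → ℤ) → ℤ
sum₀ K f = foldr _+_ 0ℤ (applyUpTo f (suc K))

-- The summands are taken in ℤ because they can be negative; each floor is
-- the floor of a non-negative rational, i.e. a quotient of naturals.
S : (m : ℕ) .{{_ : NonZero m}} → (a₁ a₂ K : ℕ) → ℤ
S m a₁ a₂ K = sum₀ K λ k →
  + ((a₁ ℕ.+ a₂ ℕ.+ k) / m) - + ((a₁ ℕ.+ k) / m) - + ((a₂ ℕ.+ k) / m) + + (k / m)

{-# OPTIONS --safe #-}
-- Let Φ(n) = Σ_{i<n} ⌊i/m⌋, a convex function of n that is piecewise linear
-- with slope c on [cm, (c+1)m].  With N = K + 1 and a₁, a₂, N ≤ m, telescoping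
-- gives
--   S = Φ(a₁+a₂+N) − Φ(a₁+a₂) − Φ(a₁+N) − Φ(a₂+N).
-- Put t = a₁+a₂+N ≤ 3m.  The three pair sums add up to 2t and Φ(n) ≥ n − m, so
-- the subtracted terms are at least 2t − 3m in total.  Either 2Φ(t) ≤ m, or
-- 2Φ(t) ≤ 4t − 5m; in both cases 2S ≤ m.
module Submission where

open import Defs
open import Data.Nat.Base as ℕ using (ℕ; zero; suc; NonZero; _∸_; z≤n) renaming (_≤_ to _≤ℕ_)
import Data.Nat.Properties as ℕ
open import Data.Nat.DivMod using (_/_; m<n*o⇒m/o<n; m≥n⇒m/n>0; /-monoˡ-≤; m*n/n≡m; +-distrib-/-∣ʳ)
open import Data.Nat.Divisibility using (n∣m*n)
open import Data.Integer.Base using (ℤ; +_; 0ℤ; _+_; _-_; -_; _≤_; +≤+)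
import Data.Integer.Properties as ℤ
open import Data.List.Base using (foldr; applyUpTo)
open import Data.Product.Base using (_,_)
open import Data.Sum.Base using (_⊎_; inj₁; inj₂)
open import Relation.Binary.PropositionalEquality
open import Function.Base using (_∘_)
import Data.Nat.Tactic.RingSolver as ℕSolver
import Data.Integer.Tactic.RingSolver as ℤSolver

Φ : (m : ℕ) .{{_ : NonZero m}} → ℕ → ℕ
Φ m zero    = 0
Φ m (suc n) = Φ m n ℕ.+ n / m

sum-telescope : (f G : ℕ → ℤ) → (∀ k → f k ≡ G (suc k) - G k) →
  ∀ n → foldr _+_ 0ℤ (applyUpTo f n) ≡ G n - G 0
sum-telescope f G step zero    = sym (ℤ.+-inverseʳ (G 0))
sum-telescope f G step (suc n) = begin
  f 0 + foldr _+_ 0ℤ (applyUpTo (f ∘ suc) n)  ≡⟨ cong₂ _+_ (step 0) (sum-telescope (f ∘ suc) (G ∘ suc) (step ∘ suc) n) ⟩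
  (G 1 - G 0) + (G (suc n) - G 1)             ≡⟨ cancel (G 1) (G 0) (G (suc n)) ⟩
  G (suc n) - G 0                             ∎
  where
  open ≡-Reasoning
  cancel : ∀ a b c → (a - b) + (c - a) ≡ c - b
  cancel = ℤSolver.solve-∀

module _ (m : ℕ) .{{_ : NonZero m}} where

  -- Every index `i` summed from `a` up to `a + d` lies below `(c + 1)m`, so `i / m ≤ c`. The
  -- starting point is free so that bounds chain at multiples of `m`.
  Φ-slope-≤ : ∀ c a d → a ℕ.+ d ≤ℕ suc c ℕ.* m → Φ m (a ℕ.+ d) ≤ℕ Φ m a ℕ.+ d ℕ.* c
  Φ-slope-≤ c a zero    h rewrite ℕ.+-identityʳ a | ℕ.+-identityʳ (Φ m a) = ℕ.≤-refl
  Φ-slope-≤ c a (suc d) h rewrite ℕ.+-suc a d = begin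
    Φ m (a ℕ.+ d) ℕ.+ (a ℕ.+ d) / m  ≤⟨ ℕ.+-mono-≤ (Φ-slope-≤ c a d (ℕ.<⇒≤ h)) (ℕ.s≤s⁻¹ (m<n*o⇒m/o<n h)) ⟩
    Φ m a ℕ.+ d ℕ.* c ℕ.+ c          ≡⟨ rearrange (Φ m a) (d ℕ.* c) c ⟩
    Φ m a ℕ.+ (c ℕ.+ d ℕ.* c)        ∎
    where
    open ℕ.≤-Reasoning
    rearrange : ∀ x y z → x ℕ.+ y ℕ.+ z ≡ x ℕ.+ (z ℕ.+ y)
    rearrange = ℕSolver.solve-∀

  Φ-vanishes : ∀ {n} → n ≤ℕ m → Φ m n ≡ 0
  Φ-vanishes {n} n≤m = ℕ.n≤0⇒n≡0 (subst (Φ m n ≤ℕ_) (ℕ.*-zeroʳ n)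
    (Φ-slope-≤ 0 0 n (subst (n ≤ℕ_) (sym (ℕ.*-identityˡ m)) n≤m)))

  -- The line `n - m` supports the convex `Φ`: up to `m` it is at most zero, and from `m` on every
  -- increment of `Φ` is at least 1.
  n≤Φ[n]+m : ∀ n → n ≤ℕ Φ m n ℕ.+ m
  n≤Φ[n]+m zero    = z≤n
  n≤Φ[n]+m (suc n) with ℕ.≤-<-connex m n
  ... | inj₂ n<m = ℕ.≤-trans n<m (ℕ.m≤n+m m _)
  ... | inj₁ m≤n = begin
    suc n                      ≤⟨ ℕ.+-mono-≤ (m≥n⇒m/n>0 m≤n) (n≤Φ[n]+m n) ⟩
    n / m ℕ.+ (Φ m n ℕ.+ m)    ≡⟨ rearrange (n / m) (Φ m n) m ⟩
    Φ m n ℕ.+ n / m ℕ.+ m      ∎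
    where
    open ℕ.≤-Reasoning
    rearrange : ∀ x y z → x ℕ.+ (y ℕ.+ z) ≡ y ℕ.+ x ℕ.+ z
    rearrange = ℕSolver.solve-∀

  Φ[m+d]≤d : ∀ {d} → d ≤ℕ m → Φ m (m ℕ.+ d) ≤ℕ d
  Φ[m+d]≤d {d} d≤m = begin
    Φ m (m ℕ.+ d)      ≤⟨ Φ-slope-≤ 1 m d (ℕ.+-monoʳ-≤ m (ℕ.≤-trans d≤m (ℕ.m≤m+n m 0))) ⟩
    Φ m m ℕ.+ d ℕ.* 1  ≡⟨ cong₂ ℕ._+_ (Φ-vanishes ℕ.≤-refl) (ℕ.*-identityʳ d) ⟩
    d                  ∎
    where open ℕ.≤-Reasoning

  Φ[2m+d]≤m+2d : ∀ {d} → d ≤ℕ m → Φ m (m ℕ.+ m ℕ.+ d) ≤ℕ m ℕ.+ d ℕ.* 2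
  Φ[2m+d]≤m+2d {d} d≤m = begin
    Φ m (m ℕ.+ m ℕ.+ d)      ≤⟨ Φ-slope-≤ 2 (m ℕ.+ m) d (subst (m ℕ.+ m ℕ.+ d ≤ℕ_) (triple m) (ℕ.+-monoʳ-≤ (m ℕ.+ m) d≤m)) ⟩
    Φ m (m ℕ.+ m) ℕ.+ d ℕ.* 2  ≤⟨ ℕ.+-monoˡ-≤ (d ℕ.* 2) (Φ[m+d]≤d ℕ.≤-refl) ⟩
    m ℕ.+ d ℕ.* 2            ∎
    where
    open ℕ.≤-Reasoning
    triple : ∀ x → x ℕ.+ x ℕ.+ x ≡ 3 ℕ.* x
    triple = ℕSolver.solve-∀

  -- The line `4t - 5m` equals `m + 2(2t - 3m)`, the bound that the pair sums will supply. It is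
  -- stated additively because subtraction on `ℕ` truncates.
  Φ-upper : ∀ t → t ≤ℕ m ℕ.+ m ℕ.+ m →
    Φ m t ℕ.* 2 ≤ℕ m ⊎ Φ m t ℕ.* 2 ℕ.+ 5 ℕ.* m ≤ℕ 4 ℕ.* t
  Φ-upper t t≤3m with ℕ.≤-total t m
  ... | inj₁ t≤m rewrite Φ-vanishes t≤m = inj₁ z≤n
  ... | inj₂ m≤t with ℕ.≤-total t (m ℕ.+ m)
  ...   | inj₁ t≤2m with ℕ.m≤n⇒∃[o]m+o≡n m≤t
  -- Both `2d`, which bounds `2Φ`, and `4t - 5m = 4d - m` take the value `m` at `d = m/2`, so the
  -- alternatives switch there.
  ...     | d , refl with ℕ.≤-total (d ℕ.* 2) m
  ...       | inj₁ 2d≤m = inj₁ (ℕ.≤-trans (ℕ.*-monoˡ-≤ 2 (Φ[m+d]≤d (ℕ.+-cancelˡ-≤ m d m t≤2m))) 2d≤m)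
  ...       | inj₂ m≤2d = inj₂ (begin
    Φ m (m ℕ.+ d) ℕ.* 2 ℕ.+ 5 ℕ.* m   ≤⟨ ℕ.+-monoˡ-≤ (5 ℕ.* m) (ℕ.*-monoˡ-≤ 2 (Φ[m+d]≤d (ℕ.+-cancelˡ-≤ m d m t≤2m))) ⟩
    d ℕ.* 2 ℕ.+ (m ℕ.+ 4 ℕ.* m)       ≤⟨ ℕ.+-monoʳ-≤ (d ℕ.* 2) (ℕ.+-monoˡ-≤ (4 ℕ.* m) m≤2d) ⟩
    d ℕ.* 2 ℕ.+ (d ℕ.* 2 ℕ.+ 4 ℕ.* m) ≡⟨ rearrange d m ⟩
    4 ℕ.* (m ℕ.+ d)                   ∎)
    where
    open ℕ.≤-Reasoning
    rearrange : ∀ d m → d ℕ.* 2 ℕ.+ (d ℕ.* 2 ℕ.+ 4 ℕ.* m) ≡ 4 ℕ.* (m ℕ.+ d)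
    rearrange = ℕSolver.solve-∀
  Φ-upper t t≤3m | inj₂ m≤t | inj₂ 2m≤t with ℕ.m≤n⇒∃[o]m+o≡n 2m≤t
  ... | d , refl = inj₂ (begin
    Φ m (m ℕ.+ m ℕ.+ d) ℕ.* 2 ℕ.+ 5 ℕ.* m  ≤⟨ ℕ.+-monoˡ-≤ (5 ℕ.* m) (ℕ.*-monoˡ-≤ 2 (Φ[2m+d]≤m+2d (ℕ.+-cancelˡ-≤ (m ℕ.+ m) d m t≤3m))) ⟩
    -- Beyond `2m` the slope bound gives `2Φ ≤ 4t - 6m`, which leaves a slack of `m`.
    (m ℕ.+ d ℕ.* 2) ℕ.* 2 ℕ.+ 5 ℕ.* m      ≤⟨ ℕ.m≤m+n _ m ⟩
    (m ℕ.+ d ℕ.* 2) ℕ.* 2 ℕ.+ 5 ℕ.* m ℕ.+ m ≡⟨ rearrange d m ⟩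
    4 ℕ.* (m ℕ.+ m ℕ.+ d)                  ∎)
    where
    open ℕ.≤-Reasoning
    rearrange : ∀ d m → (m ℕ.+ d ℕ.* 2) ℕ.* 2 ℕ.+ 5 ℕ.* m ℕ.+ m ≡ 4 ℕ.* (m ℕ.+ m ℕ.+ d)
    rearrange = ℕSolver.solve-∀

  -- Symmetric in its arguments: the number of summands `K + 1` enters on the same footing as `a₁`
  -- and `a₂`.
  pairSum : ℕ → ℕ → ℕ → ℕ
  pairSum x y z = Φ m (x ℕ.+ y) ℕ.+ Φ m (x ℕ.+ z) ℕ.+ Φ m (y ℕ.+ z)

  2Φ≤m+2pairSum : ∀ {x y z} → x ≤ℕ m → y ≤ℕ m → z ≤ℕ m →
    Φ m (x ℕ.+ y ℕ.+ z) ℕ.* 2 ≤ℕ m ℕ.+ pairSum x y z ℕ.* 2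
  2Φ≤m+2pairSum {x} {y} {z} x≤m y≤m z≤m
    with Φ-upper (x ℕ.+ y ℕ.+ z) (ℕ.+-mono-≤ (ℕ.+-mono-≤ x≤m y≤m) z≤m)
  ... | inj₁ 2Φ≤m = ℕ.≤-trans 2Φ≤m (ℕ.m≤m+n m _)
  ... | inj₂ 2Φ+5m≤4t = ℕ.+-cancelʳ-≤ (5 ℕ.* m) _ _ (begin
    Φ m (x ℕ.+ y ℕ.+ z) ℕ.* 2 ℕ.+ 5 ℕ.* m         ≤⟨ 2Φ+5m≤4t ⟩
    4 ℕ.* (x ℕ.+ y ℕ.+ z)                         ≡⟨ pairs x y z ⟩
    -- Three supporting lines, doubled, cost `6m`: the `5m` to be cancelled and the `m` of the
    -- conclusion.
    ((x ℕ.+ y) ℕ.+ (x ℕ.+ z) ℕ.+ (y ℕ.+ z)) ℕ.* 2 ≤⟨ ℕ.*-monoˡ-≤ 2 (ℕ.+-mono-≤ (ℕ.+-mono-≤ (n≤Φ[n]+m (x ℕ.+ y)) (n≤Φ[n]+m (x ℕ.+ z))) (n≤Φ[n]+m (y ℕ.+ z))) ⟩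
    _                                             ≡⟨ rearrange (Φ m (x ℕ.+ y)) (Φ m (x ℕ.+ z)) (Φ m (y ℕ.+ z)) m ⟩
    m ℕ.+ pairSum x y z ℕ.* 2 ℕ.+ 5 ℕ.* m         ∎)
    where
    open ℕ.≤-Reasoning
    pairs : ∀ x y z → 4 ℕ.* (x ℕ.+ y ℕ.+ z) ≡ ((x ℕ.+ y) ℕ.+ (x ℕ.+ z) ℕ.+ (y ℕ.+ z)) ℕ.* 2
    pairs = ℕSolver.solve-∀
    rearrange : ∀ p q r m → ((p ℕ.+ m) ℕ.+ (q ℕ.+ m) ℕ.+ (r ℕ.+ m)) ℕ.* 2 ≡ m ℕ.+ (p ℕ.+ q ℕ.+ r) ℕ.* 2 ℕ.+ 5 ℕ.* m
    rearrange = ℕSolver.solve-∀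

  -- The doubled pair sum is even, so halving splits it off exactly and the floor falls on `m`
  -- alone.
  Φ≤m/2+pairSum : ∀ {x y z} → x ≤ℕ m → y ≤ℕ m → z ≤ℕ m →
    Φ m (x ℕ.+ y ℕ.+ z) ≤ℕ m / 2 ℕ.+ pairSum x y z
  Φ≤m/2+pairSum {x} {y} {z} x≤m y≤m z≤m = begin
    Φ m (x ℕ.+ y ℕ.+ z)                ≡⟨ m*n/n≡m _ 2 ⟨
    Φ m (x ℕ.+ y ℕ.+ z) ℕ.* 2 / 2      ≤⟨ /-monoˡ-≤ 2 (2Φ≤m+2pairSum x≤m y≤m z≤m) ⟩
    (m ℕ.+ pairSum x y z ℕ.* 2) / 2    ≡⟨ +-distrib-/-∣ʳ m (n∣m*n (pairSum x y z)) ⟩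
    m / 2 ℕ.+ pairSum x y z ℕ.* 2 / 2  ≡⟨ cong (m / 2 ℕ.+_) (m*n/n≡m (pairSum x y z) 2) ⟩
    m / 2 ℕ.+ pairSum x y z            ∎
    where open ℕ.≤-Reasoning

  -- The summand of `S` with each floor `n / m` replaced by `Φ m n`, whose increment at `n` is that
  -- floor.
  antidifference : ℕ → ℕ → ℕ → ℤ
  antidifference x y k = + Φ m (x ℕ.+ y ℕ.+ k) - + Φ m (x ℕ.+ k) - + Φ m (y ℕ.+ k) + + Φ m k

  S-telescoped : ∀ x y K → S m x y K ≡ antidifference x y (suc K) - antidifference x y 0
  S-telescoped x y K = sum-telescope _ (antidifference x y) step (suc K)
    where
    difference : ∀ p q r s a b c d →
      a - b - c + d ≡ ((p + a) - (q + b) - (r + c) + (s + d)) - (p - q - r + s)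
    difference = ℤSolver.solve-∀
    step : ∀ k →
      + ((x ℕ.+ y ℕ.+ k) / m) - + ((x ℕ.+ k) / m) - + ((y ℕ.+ k) / m) + + (k / m)
        ≡ antidifference x y (suc k) - antidifference x y k
    -- With each `suc` moved outermost, `Φ` unfolds by its recursion and a ring identity remains.
    step k rewrite ℕ.+-suc (x ℕ.+ y) k | ℕ.+-suc x k | ℕ.+-suc y k =
      difference (+ Φ m (x ℕ.+ y ℕ.+ k)) (+ Φ m (x ℕ.+ k)) (+ Φ m (y ℕ.+ k)) (+ Φ m k)
        (+ ((x ℕ.+ y ℕ.+ k) / m)) (+ ((x ℕ.+ k) / m)) (+ ((y ℕ.+ k) / m)) (+ (k / m))

  -- `Φ` vanishes at `x`, `y` and `K + 1`. The value at `x + y` comes from the lower endpoint and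
  -- joins the two terms subtracted at the upper one.
  S-closed : ∀ {x y K} → x ≤ℕ m → y ≤ℕ m → suc K ≤ℕ m →
    S m x y K ≡ + Φ m (x ℕ.+ y ℕ.+ suc K) - + pairSum x y (suc K)
  S-closed {x} {y} {K} x≤m y≤m K<m
    rewrite S-telescoped x y K
          | ℕ.+-identityʳ (x ℕ.+ y) | ℕ.+-identityʳ x | ℕ.+-identityʳ y
          | Φ-vanishes x≤m | Φ-vanishes y≤m | Φ-vanishes K<m
    = regroup (+ Φ m (x ℕ.+ y ℕ.+ suc K)) (+ Φ m (x ℕ.+ y)) (+ Φ m (x ℕ.+ suc K)) (+ Φ m (y ℕ.+ suc K))
    where
    regroup : ∀ t p q r → (t - q - r + 0ℤ) - (p - 0ℤ - 0ℤ + 0ℤ) ≡ t - (p + q + r)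
    regroup = ℤSolver.solve-∀

corollary8 : (m : ℕ) .{{_ : NonZero m}} → (a₁ a₂ K : ℕ) →
    a₁ ≤ℕ m ∸ 1 → a₂ ≤ℕ m ∸ 1 → K ≤ℕ m ∸ 1 →
    S m a₁ a₂ K ≤ + (m / 2)
corollary8 m@(suc m-1) a₁ a₂ K a₁<m a₂<m K<m = begin
  -- Matching `m` as a successor makes `m ∸ 1` compute, so the bound on `K` says that the `K + 1`
  -- summands number at most `m`.
  S m a₁ a₂ K                     ≡⟨ S-closed m a₁≤m a₂≤m (ℕ.s≤s K<m) ⟩
  + Φ m (a₁ ℕ.+ a₂ ℕ.+ suc K) - + Q  ≤⟨ ℤ.+-monoˡ-≤ (- + Q) (+≤+ (Φ≤m/2+pairSum m a₁≤m a₂≤m (ℕ.s≤s K<m))) ⟩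
  (+ (m / 2) + + Q) - + Q         ≡⟨ cancel (+ (m / 2)) (+ Q) ⟩
  + (m / 2)                       ∎
  where
  open ℤ.≤-Reasoning
  Q = pairSum m a₁ a₂ (suc K)
  a₁≤m = ℕ.m≤n⇒m≤1+n a₁<m
  a₂≤m = ℕ.m≤n⇒m≤1+n a₂<m
  cancel : ∀ a b → (a + b) - b ≡ a
  cancel = ℤSolver.solve-∀
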